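{- Let $n \ge 5$, let $T$ be a tree with vertex set $\{1,2,\ldots,n\}$, and let $\beta$ be a value obtained by Algorithm A for input $T$ (for any choices of vertex pairs made in its step A2). Then $$\beta \le \max_{\pi \in S_n} \left\{c(\pi)-n+\sum_{i=1}^n \mathrm{dist}_T(i,\pi(i)) \right\}.$$
   Context: $S_n$ is the symmetric group on $\{1,\ldots,n\}$. $\mathrm{dist}_T(u,v)$ is the distance between vertices $u,v$ in $T$ and $\mathrm{diam}(T)$ is the diameter of $T$. $c(\pi)$ is the number of cycles of $\pi$, including cycles of length 1. Algorithm A (input: a tree $T$; output: a number $\beta$). A1. Set $\beta \leftarrow 0$. A2. Find any two vertices $i,j$ of the current tree $T$ such that $\mathrm{dist}_T(i,j)=\mathrm{diam}(T)$. A3. Set $\beta \leftarrow \beta+(2\,\mathrm{diam}(T)-1)$ (with $T$ the current tree), and then set $T \leftarrow T-\{i,j\}$ (delete the vertices $i,j$). If $T$ still has 3 or more vertices, return to step A2; otherwise, set $\beta \leftarrow \beta+|V(T)|-1$ and terminate with output $\beta$. The output can depend on the choices of vertex pairs made in step A2. -}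

module Defs where

open import Data.Bool.Properties using () renaming (_≟_ to _≟ᵇ_)
open import Data.Fin using (Fin; zero; suc; toℕ; fromℕ<; punchIn)
open import Data.Fin.Permutation using (Permutation′; _⟨$⟩ʳ_; _≈_; id; insert; remove; insert-remove)
open import Data.Fin.Properties using (_≟_; any?; pigeonhole; toℕ<n; toℕ-fromℕ<)
open import Data.Fin.Subset using (Subset; _∈_; Nonempty; ∣_∣; _-_)
open import Data.Fin.Subset.Properties using (_∈?_; x∈p∧x≢y⇒x∈p-y)
open import Data.Integer using (ℤ; +_; 0ℤ; 1ℤ) renaming (_+_ to _+ℤ_; _-_ to _-ℤ_; _*_ to _*ℤ_; _≤_ to _≤ℤ_)
import Data.Integer.Properties as ℤ
open import Data.List using (List; []; _∷_; _∷ʳ_; map; length; filter; allFin; deduplicate; cartesianProductWith)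
import Data.List.Extrema as Extrema
import Data.List.Extrema.Nat as ExtremaNat
open import Data.List.Membership.Propositional using () renaming (_∈_ to _∈ˡ_)
open import Data.List.Membership.Propositional.Properties using (∈-map⁺; ∈-map⁻; ∈-allFin; ∈-cartesianProductWith⁺)
open import Data.List.Relation.Unary.Any using (here)
open import Data.List.Relation.Unary.All using () renaming (lookup to lookupAll)
open import Data.List.Relation.Unary.Linked using (Linked)
open import Data.List.Relation.Unary.Unique.Propositional using (Unique)
open import Data.Nat using (ℕ; zero; suc; _+_; _∸_; _≤_; _<_; z≤n; s≤s; _<?_)
open import Data.Nat.Induction using (<-rec)
open import Data.Nat.Properties using (≤-reflexive; <-≤-trans; ≮⇒≥; ≤-pred; +-comm; +-monoˡ-<; m+[n∸m]≡n)
open import Data.Product using (∃-syntax; _×_; _,_)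
open import Data.Sum using (inj₁; inj₂)
open import Data.Vec using (tabulate)
open import Data.Vec.Properties using (≡-dec; lookup∘tabulate; lookup⇒[]=; []=⇒lookup)
open import Function using (_∘_; _⇔_; mk⇔; Inverse)
open import Level using (0ℓ)
open import Relation.Binary using (Rel; Decidable; Symmetric)
open import Relation.Binary.PropositionalEquality using (_≡_; _≢_; refl; sym; trans; cong; subst)
open import Relation.Nullary using (¬_; Dec; yes; no; does; contradiction)
open import Relation.Nullary.Decidable using (map′; _×-dec_; dec-true; ¬?)
import Relation.Unary as U

private
  variable
    n : ℕ

-- Deleting vertices keeps the labels of the remaining ones, so the vertex set
-- is a subset of Fin n.

record Graph (n : ℕ) : Set₁ where
  field
    V      : Subset n
    Adj    : Rel (Fin n) 0ℓ
    adj?   : Decidable Adj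
    symm   : Symmetric Adj
    irrefl : ∀ {u} → ¬ Adj u u
    Adj⇒∈V : ∀ {u v} → Adj u v → u ∈ V

open Graph public

infixl 6 _∖_

_∖_ : Graph n → Fin n → Graph n
G ∖ i = record
  { V      = V G - i
  ; Adj    = λ u v → Adj G u v × u ≢ i × v ≢ i
  ; adj?   = λ u v → adj? G u v ×-dec ¬? (u ≟ i) ×-dec ¬? (v ≟ i)
  ; symm   = λ (a , p , q) → symm G a , q , p
  ; irrefl = λ (a , _) → irrefl G a
  ; Adj⇒∈V = λ (a , p , _) → x∈p∧x≢y⇒x∈p-y (Adj⇒∈V G a) p
  }

data Walk (G : Graph n) : ℕ → Fin n → Fin n → Set where
  nil  : ∀ {u} → u ∈ V G → Walk G 0 u u
  cons : ∀ {k u w v} → Adj G u w → Walk G k w v → Walk G (suc k) u v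

walk? : ∀ (G : Graph n) k u v → Dec (Walk G k u v)
walk? G zero u v = map′ (λ { (refl , p) → nil p }) (λ { (nil p) → refl , p }) (u ≟ v ×-dec (u ∈? V G))
walk? G (suc k) u v = map′ (λ (w , a , p) → cons a p) (λ { (cons a p) → _ , a , p })
  (any? λ w → adj? G u w ×-dec walk? G k w v)

-- A cycle is a list x₀ , x₁ , … of at least three distinct vertices,
-- consecutive ones adjacent and the last one adjacent to x₀.

IsCycle : Graph n → Fin n → List (Fin n) → Set
IsCycle G x xs = 2 ≤ length xs × Unique (x ∷ xs) × Linked (Adj G) (x ∷ xs ∷ʳ x)

record IsTree (G : Graph n) : Set where
  field
    nonempty  : Nonempty (V G)
    connected : ∀ {u v} → u ∈ V G → v ∈ V G → ∃[ k ] Walk G k u v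
    acyclic   : ∀ {x xs} → ¬ IsCycle G x xs

-- The least k < b with P k, or b if there is none.

least : {P : U.Pred ℕ 0ℓ} → U.Decidable P → ℕ → ℕ
least P? zero = zero
least P? (suc b) with P? 0
... | yes _ = 0
... | no  _ = suc (least (P? ∘ suc) b)

-- Only lengths below n are searched; dist-walk and dist-≤ show that this
-- gives the length of a shortest walk.

dist : Graph n → Fin n → Fin n → ℕ
dist {n} G u v = least (λ k → walk? G k u v) n

vertices : Graph n → List (Fin n)
vertices {n} G = filter (_∈? V G) (allFin n)

diam : Graph n → ℕ
diam G = ExtremaNat.max 0 (cartesianProductWith (dist G) (vertices G) (vertices G))

iter : Permutation′ n → ℕ → Fin n → Fin n
iter {n} π k = (π ⟨$⟩ʳ_) ^ k
  where open import Function.Endo.Propositional (Fin n) using (_^_)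

-- Powers below n already exhaust the orbit: see ∈-orbit.

orbit : Permutation′ n → Fin n → Subset n
orbit {n} π i = tabulate λ j → does (any? λ (k : Fin n) → iter π (toℕ k) i ≟ j)

-- The cycles of π, fixed points included, are its distinct orbits.

cycleCount : Permutation′ n → ℕ
cycleCount {n} π = length (deduplicate (≡-dec _≟ᵇ_) (map (orbit π) (allFin n)))

-- A permutation of Fin (suc n) is determined by the image j of zero and the
-- permutation left after removing zero and j (permutations-complete).

permutations : ∀ n → List (Permutation′ n)
permutations zero    = id ∷ []
permutations (suc n) = cartesianProductWith (insert zero) (allFin (suc n)) (permutations n)

maxPerm : (Permutation′ n → ℤ) → ℤ
maxPerm {n} f = Extrema.max ℤ.≤-totalOrder (f id) (map f (permutations n))

record Diametral (T : Graph n) (i j : Fin n) : Set where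
  field
    i∈V   : i ∈ V T
    j∈V   : j ∈ V T
    i≢j   : i ≢ j
    dist≡ : dist T i j ≡ diam T

-- Run T β r: entering step A2 with current tree T and accumulator β, some
-- choice of vertex pairs leads to output r.

data Run {n} : Graph n → ℤ → ℤ → Set₁ where
  loop : ∀ {T β r i j} → Diametral T i j → 3 ≤ ∣ V (T ∖ i ∖ j) ∣ →
         Run (T ∖ i ∖ j) (β +ℤ (+ 2 *ℤ + diam T -ℤ 1ℤ)) r →
         Run T β r
  halt : ∀ {T β i j} → Diametral T i j → ∣ V (T ∖ i ∖ j) ∣ < 3 →
         Run T β (β +ℤ (+ 2 *ℤ + diam T -ℤ 1ℤ) +ℤ (+ ∣ V (T ∖ i ∖ j) ∣ -ℤ 1ℤ))

AlgorithmA : Graph n → ℤ → Set₁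
AlgorithmA T β = Run T 0ℤ β

private
  least-≤ : ∀ {P : U.Pred ℕ 0ℓ} (P? : U.Decidable P) b {k} → P k → least P? b ≤ k
  least-≤ P? zero p = z≤n
  least-≤ P? (suc b) {k} p with P? 0
  ... | yes _ = z≤n
  least-≤ P? (suc b) {zero}  p | no ¬p = contradiction p ¬p
  least-≤ P? (suc b) {suc k} p | no ¬p = s≤s (least-≤ (P? ∘ suc) b p)

  least-holds : ∀ {P : U.Pred ℕ 0ℓ} (P? : U.Decidable P) b {k} → k < b → P k → P (least P? b)
  least-holds P? (suc b) {k} k<b p with P? 0
  ... | yes p₀ = p₀
  least-holds P? (suc b) {zero}  k<b       p | no ¬p = contradiction p ¬p
  least-holds P? (suc b) {suc k} (s≤s k<b) p | no ¬p = least-holds (P? ∘ suc) b k<b p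

  module _ {G : Graph n} where

    start : ∀ {k u v} → Walk G k u v → u ∈ V G
    start (nil p)    = p
    start (cons a _) = Adj⇒∈V G a

    vertexAt : ∀ {k u v} → Walk G k u v → Fin (suc k) → Fin n
    vertexAt {u = u} w  zero    = u
    vertexAt (cons a w) (suc i) = vertexAt w i

    takeW : ∀ {k u v} (w : Walk G k u v) i → Walk G (toℕ i) u (vertexAt w i)
    takeW w zero             = nil (start w)
    takeW (cons a w) (suc i) = cons a (takeW w i)

    dropW : ∀ {k u v} (w : Walk G k u v) i → Walk G (k ∸ toℕ i) (vertexAt w i) v
    dropW w zero             = w
    dropW (cons a w) (suc i) = dropW w i

    _++W_ : ∀ {k l u v w} → Walk G k u v → Walk G l v w → Walk G (k + l) u w
    nil _    ++W q = q
    cons a p ++W q = cons a (p ++W q)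

    shorten : ∀ k {u v} → Walk G k u v → ∃[ l ] l < n × Walk G l u v
    shorten = <-rec _ go
      where
      go : ∀ k → (∀ {l} → l < k → ∀ {u v} → Walk G l u v → ∃[ m ] m < n × Walk G m u v) →
           ∀ {u v} → Walk G k u v → ∃[ m ] m < n × Walk G m u v
      go k rec w with k <? n
      ... | yes k<n = k , k<n , w
      ... | no  k≮n =
        let i , j , i<j , eq = pigeonhole (s≤s (≮⇒≥ k≮n)) (vertexAt w)
            j≤k = ≤-pred (toℕ<n j)
            lt  = <-≤-trans (+-monoˡ-< (k ∸ toℕ j) i<j) (≤-reflexive (m+[n∸m]≡n j≤k))
        in rec lt (subst (Walk G (toℕ i) _) eq (takeW w i) ++W dropW w j)

dist-walk : ∀ (G : Graph n) {k u v} → Walk G k u v → Walk G (dist G u v) u v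
dist-walk {n} G w with shorten _ w
... | l , l<n , w′ = least-holds (λ k → walk? G k _ _) n l<n w′

dist-≤ : ∀ (G : Graph n) {k u v} → Walk G k u v → dist G u v ≤ k
dist-≤ {n} G w = least-≤ (λ k → walk? G k _ _) n w

private
  iter-+ : ∀ (π : Permutation′ n) k l i → iter π (k + l) i ≡ iter π k (iter π l i)
  iter-+ π zero    l i = refl
  iter-+ π (suc k) l i = cong (π ⟨$⟩ʳ_) (iter-+ π k l i)

  iter-injective : ∀ (π : Permutation′ n) k {i j} → iter π k i ≡ iter π k j → i ≡ j
  iter-injective π zero    eq = eq
  iter-injective π (suc k) eq = iter-injective π k
    (trans (sym (Inverse.strictlyInverseʳ π _)) (trans (cong (Inverse.from π) eq) (Inverse.strictlyInverseʳ π _)))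

  reduce : ∀ (π : Permutation′ n) i k → ∃[ l ] iter π (toℕ {n} l) i ≡ iter π k i
  reduce {n} π i = <-rec _ go
    where
    go : ∀ k → (∀ {l} → l < k → ∃[ m ] iter π (toℕ {n} m) i ≡ iter π l i) →
         ∃[ m ] iter π (toℕ {n} m) i ≡ iter π k i
    go k rec with k <? n
    ... | yes k<n = fromℕ< k<n , cong (λ l → iter π l i) (toℕ-fromℕ< k<n)
    ... | no  k≮n =
      let a , b , a<b , eq = pigeonhole (s≤s (≮⇒≥ k≮n)) (λ (a : Fin (suc k)) → iter π (toℕ a) i)
          b≤k  = ≤-pred (toℕ<n b)
          r    = k ∸ toℕ b
          lt   = <-≤-trans (+-monoˡ-< r a<b) (≤-reflexive (m+[n∸m]≡n b≤k))
          m , em = rec lt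
      in m , trans em (trans (swap (toℕ a) r) (trans (cong (iter π r) eq)
               (trans (sym (swap (toℕ b) r)) (cong (λ l → iter π l i) (m+[n∸m]≡n b≤k)))))
      where
      swap : ∀ p q → iter π (p + q) i ≡ iter π q (iter π p i)
      swap p q = trans (cong (λ l → iter π l i) (+-comm p q)) (iter-+ π q p i)

∈-orbit : ∀ (π : Permutation′ n) {i j} → j ∈ orbit π i ⇔ (∃[ k ] iter π k i ≡ j)
∈-orbit {n} π {i} {j} = mk⇔ to from
  where
  d = any? λ (k : Fin n) → iter π (toℕ k) i ≟ j
  lk = lookup∘tabulate (λ j → does (any? λ (k : Fin n) → iter π (toℕ k) i ≟ j)) j

  to : j ∈ orbit π i → ∃[ k ] iter π k i ≡ j
  to p with d | trans (sym lk) ([]=⇒lookup p)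
  ... | yes (k , e) | _ = toℕ k , e

  from : ∃[ k ] iter π k i ≡ j → j ∈ orbit π i
  from (k , e) = let l , el = reduce π i k in
    lookup⇒[]= j _ (trans lk (dec-true d (l , trans el e)))

permutations-complete : (π : Permutation′ n) → ∃[ ρ ] ρ ∈ˡ permutations n × ρ ≈ π
permutations-complete {zero}  π = id , here refl , λ ()
permutations-complete {suc n} π with permutations-complete (remove zero π)
... | ρ , ρ∈ , ρ≈ = insert zero (π ⟨$⟩ʳ zero) ρ
    , ∈-cartesianProductWith⁺ (insert zero) (∈-allFin _) ρ∈
    , λ { zero    → refl
        ; (suc k) → trans (cong (punchIn (π ⟨$⟩ʳ zero)) (ρ≈ k)) (insert-remove zero π (suc k)) }

maxPerm-attained : (f : Permutation′ n → ℤ) → ∃[ π ] maxPerm f ≡ f π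
maxPerm-attained {n} f with Extrema.argmax-sel ℤ.≤-totalOrder (λ x → x) (f id) (map f (permutations n))
... | inj₁ e = id , e
... | inj₂ m = let π , _ , e = ∈-map⁻ f m in π , e

maxPerm-upper : (f : Permutation′ n → ℤ) → (∀ {π ρ} → π ≈ ρ → f π ≡ f ρ) → ∀ π → f π ≤ℤ maxPerm f
maxPerm-upper {n} f f-cong π with permutations-complete π
... | ρ , ρ∈ , ρ≈π = subst (_≤ℤ maxPerm f) (f-cong ρ≈π)
  (lookupAll (Extrema.xs≤max ℤ.≤-totalOrder (f id) (map f (permutations n))) (∈-map⁺ f ρ∈))

{-# OPTIONS --safe #-}
-- Take π to be the product of the disjoint transpositions (i j) of the pairs
-- deleted by the algorithm, together with the transposition of the last two
-- vertices when two remain.  Endpoints of a diameter are leaves, so deleting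
-- them does not change the distances between the other vertices; a pair at
-- distance d therefore contributes 2d to the sum and costs one cycle.

module Submission where

open import Defs
open import Data.Bool using (true; false)
open import Data.Bool.Properties using () renaming (_≟_ to _≟ᵇ_)
open import Data.Fin using (Fin; zero; suc; punchIn)
open import Data.Fin.Permutation using (Permutation′; _⟨$⟩ʳ_; _≈_; _∘ₚ_; id; transpose)
open import Data.Fin.Properties using (_≟_; any?; injective⇒≤; punchIn-injective; punchInᵢ≢i)
open import Data.Fin.Subset using (Subset; ⊤; _∈_; _∉_; Nonempty; ∣_∣; _-_; _⊆_; ⁅_⁆)
open import Data.Fin.Subset.Properties using (_∈?_; ∈⊤; p─q⊆p; ⊆-antisym; x∈p∧x≢y⇒x∈p-y)
open import Data.Integer using (ℤ; +_; 0ℤ; 1ℤ) renaming (_+_ to _+ℤ_; _-_ to _-ℤ_; _*_ to _*ℤ_; _≤_ to _≤ℤ_)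
import Data.Integer as ℤ
import Data.Integer.Properties as ℤ
open import Data.Integer.Tactic.RingSolver using (solve-∀)
open import Data.List using (List; []; _∷_; _∷ʳ_; map; length; deduplicate; allFin)
open import Data.List.Extrema.Nat using (xs≤max)
open import Data.List.Membership.DecPropositional using () renaming (_∈?_ to ∈ˡ?)
open import Data.List.Membership.Propositional using () renaming (_∈_ to _∈ˡ_)
open import Data.List.Membership.Propositional.Properties
  using (∈-map⁺; ∈-allFin; ∈-filter⁺; ∈-cartesianProductWith⁺; ∈-deduplicate⁺)
open import Data.List.Membership.Setoid.Properties using (index-injective)
open import Data.List.Properties using (map-cong)
open import Data.List.Relation.Unary.All using (All; []; _∷_)
import Data.List.Relation.Unary.All as All
open import Data.List.Relation.Unary.All.Properties using (¬Any⇒All¬)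
open import Data.List.Relation.Unary.AllPairs using ([]; _∷_)
open import Data.List.Relation.Unary.Any using (here; there; index)
open import Data.List.Relation.Unary.Linked using (Linked; [-]; _∷_)
import Data.List.Relation.Unary.Linked as Linked
open import Data.List.Relation.Unary.Unique.Propositional using (Unique)
open import Data.Nat using (ℕ; zero; suc; _+_; _≤_; _<_; z≤n; s≤s)
open import Data.Nat.ListAction using (sum)
import Data.Nat.Properties as ℕ
import Algebra.Properties.CommutativeSemigroup ℕ.+-commutativeSemigroup as ℕ+
open import Data.Product using (∃-syntax; _×_; _,_; proj₁; proj₂; map₂)
open import Data.Sum using (_⊎_; inj₁; inj₂; [_,_]′)
open import Data.Vec using (_∷_; here; there)
open import Data.Vec.Properties using (≡-dec)
open import Function using (_∘_; Injective; Equivalence)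
open import Level using (0ℓ)
open import Relation.Binary using (Rel)
open import Relation.Binary.PropositionalEquality
  using (_≡_; _≢_; refl; sym; trans; cong; cong₂; subst; setoid)
open import Relation.Nullary using (¬_; yes; no; contradiction)

private
  variable
    n k l : ℕ
    G : Graph n
    i j u v w : Fin n

-- Finite subsets: deletion and extraction of elements.

x∉p-x : ∀ (p : Subset n) {x} → x ∉ p - x
x∉p-x (_ ∷ p) {suc x} (there x∈) = x∉p-x p x∈

∈-∖⁻ : ∀ (p : Subset n) → u ∈ p - i → u ∈ p × u ≢ i
∈-∖⁻ {i = i} p u∈ = p─q⊆p p ⁅ i ⁆ u∈ , λ { refl → x∉p-x p u∈ }

∣p∣>0⇒Nonempty : ∀ (p : Subset n) → 1 ≤ ∣ p ∣ → Nonempty p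
∣p∣>0⇒Nonempty (true  ∷ p) _  = zero , here
∣p∣>0⇒Nonempty (false ∷ p) 1≤ with ∣p∣>0⇒Nonempty p 1≤
... | x , x∈ = suc x , there x∈

∣p∣>1⇒distinct : ∀ (p : Subset n) → 2 ≤ ∣ p ∣ → ∃[ x ] ∃[ y ] x ∈ p × y ∈ p × x ≢ y
∣p∣>1⇒distinct (true ∷ p) (s≤s 1≤) with ∣p∣>0⇒Nonempty p 1≤
... | y , y∈ = zero , suc y , here , there y∈ , λ ()
∣p∣>1⇒distinct (false ∷ p) 2≤ with ∣p∣>1⇒distinct p 2≤
... | x , y , x∈ , y∈ , x≢y = suc x , suc y , there x∈ , there y∈ , λ { refl → x≢y refl }

-- Walks and paths

source∈V : Walk G k u v → u ∈ V G
source∈V         (nil u∈)   = u∈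
source∈V {G = G} (cons a _) = Adj⇒∈V G a

_++ʷ_ : Walk G k u v → Walk G l v w → Walk G (k + l) u w
nil _    ++ʷ q = q
cons a p ++ʷ q = cons a (p ++ʷ q)

reverseʷ : Walk G k u v → Walk G k v u
reverseʷ (nil u∈) = nil u∈
reverseʷ {G = G} {k = suc k} {u} {v} (cons a p) =
  subst (λ l → Walk G l v u) (ℕ.+-comm k 1) (reverseʷ p ++ʷ cons (symm G a) (nil (Adj⇒∈V G a)))

-- The walk is followed up to its first visit to `i`, if there is one. Keeping `a + b ≡ k` exact
-- lets the part after `i` be compared with a shortest walk.
avoid-or-visit : ∀ i → Walk G k u v →
  Walk (G ∖ i) k u v ⊎ (∃[ a ] ∃[ b ] a + b ≡ k × Walk G a u i × Walk G b i v)
avoid-or-visit {u = u} i p with u ≟ i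
... | yes refl = inj₂ (0 , _ , refl , nil (source∈V p) , p)
avoid-or-visit i (nil u∈) | no u≢i = inj₁ (nil (x∈p∧x≢y⇒x∈p-y u∈ u≢i))
avoid-or-visit {G = G} i (cons a p) | no u≢i with avoid-or-visit i p
... | inj₁ q = inj₁ (cons (a , u≢i , proj₂ (∈-∖⁻ (V G) (source∈V q))) q)
... | inj₂ (b , c , b+c≡k , q , r) = inj₂ (suc b , c , cong suc b+c≡k , cons a q , r)

-- Unlike `Walk`, this records the vertices rather than the length. The list omits the starting
-- point, as `IsCycle` keeps its first vertex apart.
data Path {A : Set} (R : Rel A 0ℓ) : A → A → List A → Set where
  []  : ∀ {x} → Path R x x []
  _∷_ : ∀ {x y z xs} → R x y → Path R y z xs → Path R x z (y ∷ xs)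

module _ {A : Set} {R : Rel A 0ℓ} where

  path-suffix : ∀ {x y z xs} → y ∈ˡ x ∷ xs → Path R x z xs → Unique (x ∷ xs) →
                ∃[ ys ] Path R y z ys × Unique (y ∷ ys)
  path-suffix (here refl) p        uniq       = _ , p , uniq
  path-suffix (there y∈)  (_ ∷ p) (_ ∷ uniq) = path-suffix y∈ p uniq

-- Loop erasure: if `u` reappears on the path already built from its successor, everything before
-- that occurrence is dropped.
walk⇒path : Walk G k u v → ∃[ xs ] Path (Adj G) u v xs × Unique (u ∷ xs)
walk⇒path (nil _) = [] , [] , [] ∷ []
walk⇒path {u = u} (cons {w = w} a p) with walk⇒path p
... | xs , q , uniq with ∈ˡ? _≟_ u (w ∷ xs)
...   | yes u∈ = path-suffix u∈ q uniq
...   | no  u∉ = w ∷ xs , a ∷ q , ¬Any⇒All¬ (w ∷ xs) u∉ ∷ uniq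

-- Trees and leaves

Acyclic : Graph n → Set
Acyclic G = ∀ {x xs} → ¬ IsCycle G x xs

-- At most one neighbour rather than exactly one, so that the property survives the deletion of
-- other vertices, even of that neighbour.
Leaf : Graph n → Fin n → Set
Leaf G i = ∀ {u v} → Adj G i u → Adj G i v → u ≡ v

-- Otherwise i together with a path from u to v avoiding i would be a cycle.
neighbours-separated : Acyclic G → Adj G i u → Adj G i v → Walk (G ∖ i) k u v → u ≡ v
neighbours-separated {G = G} {i = i} {v = v} acyclic i~u i~v p with walk⇒path p
... | [] , [] , _ = refl
... | x ∷ xs , q , uniq = contradiction
  (s≤s (s≤s z≤n) , ((λ { refl → irrefl G i~u }) ∷ avoids q) ∷ uniq , i~u ∷ close q) acyclic
  where
  avoids : ∀ {u v xs} → Path (Adj (G ∖ i)) u v xs → All (i ≢_) xs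
  avoids []                  = []
  avoids ((_ , _ , x≢i) ∷ p) = (x≢i ∘ sym) ∷ avoids p

  close : ∀ {u xs} → Path (Adj (G ∖ i)) u v xs → Linked (Adj G) (u ∷ xs ∷ʳ i)
  close []            = symm G i~v ∷ [-]
  close ((a , _) ∷ p) = a ∷ close p

-- Let `p` be the first vertex after `i` on a shortest walk to `j`. For any neighbour `u` of `i`, a
-- shortest walk from `u` to `j` has length at most `dist G i j`, hence cannot pass through `i`. So
-- `u` and `p` are joined through `j` off `i`, and acyclicity forces them to coincide.
eccentric⇒leaf : IsTree G → i ∈ V G → j ∈ V G → i ≢ j →
                 (∀ {u} → u ∈ V G → dist G u j ≤ dist G i j) → Leaf G i
eccentric⇒leaf {G = G} {i = i} {j = j} tree i∈ j∈ i≢j furthest i~u i~v =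
  trans (proj₂ hub i~u) (sym (proj₂ hub i~v))
  where
  open IsTree tree

  geodesic : ∀ {u} → u ∈ V G → Walk G (dist G u j) u j
  geodesic u∈ = dist-walk G (proj₂ (connected u∈ j∈))

  neighbour≡ : ∀ {k l p u} → Adj G i p → Walk (G ∖ i) k p j → Adj G i u →
               Walk G l u j → l ≤ dist G i j → u ≡ p
  neighbour≡ i~p p i~u q l≤ with avoid-or-visit i q
  ... | inj₁ q′ = neighbours-separated {G = G} acyclic i~u i~p (_++ʷ_ {G = G ∖ i} q′ (reverseʷ {G = G ∖ i} p))
  ... | inj₂ (zero  , _ , _    , nil _ , _) = contradiction i~u (irrefl G)
  -- The part `r` after `i` has length `b`, at least `dist G i j`, while the whole walk has length
  -- `suc a + b`, at most `dist G i j`.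
  ... | inj₂ (suc a , b , refl , _     , r) =
    contradiction (ℕ.≤-trans l≤ (dist-≤ G r)) (ℕ.<⇒≱ (s≤s (ℕ.m≤n+m b a)))

  first-step : ∀ {k} → Walk G k i j → k ≤ dist G i j → ∃[ p ] (∀ {u} → Adj G i u → u ≡ p)
  first-step (nil _) _ = contradiction refl i≢j
  first-step (cons i~p p) k≤ with avoid-or-visit i p
  ... | inj₁ p′ = _ , λ i~u →
    let u∈ = Adj⇒∈V G (symm G i~u) in neighbour≡ i~p p′ i~u (geodesic u∈) (furthest u∈)
  -- A return to `i` would make `r` a walk from `i` to `j` shorter than the geodesic.
  ... | inj₂ (a , b , refl , _ , r) =
    contradiction (ℕ.≤-trans k≤ (dist-≤ G r)) (ℕ.<⇒≱ (s≤s (ℕ.m≤n+m b a)))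

  hub = first-step (geodesic i∈) ℕ.≤-refl

-- A walk that enters a leaf must leave it by the same neighbour, so each such excursion can be cut
-- out, saving two steps.
bypass-leaf : Leaf G i → Walk G k u v → u ≢ i → v ≢ i → ∃[ l ] l ≤ k × Walk (G ∖ i) l u v
bypass-leaf leaf (nil u∈) u≢i _ = 0 , z≤n , nil (x∈p∧x≢y⇒x∈p-y u∈ u≢i)
bypass-leaf {G = G} {i = i} leaf (cons {w = w} a p) u≢i v≢i with w ≟ i
bypass-leaf leaf (cons a p) u≢i v≢i | no w≢i with bypass-leaf leaf p w≢i v≢i
... | l , l≤k , q = suc l , s≤s l≤k , cons (a , u≢i , w≢i) q
bypass-leaf leaf (cons a (nil _)) u≢i v≢i | yes refl = contradiction refl v≢i
bypass-leaf {G = G} leaf (cons a (cons b p)) u≢i v≢i | yes refl with leaf (symm G a) b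
... | refl with bypass-leaf leaf p u≢i v≢i
...   | l , l≤k , q = l , ℕ.m≤n⇒m≤1+n (ℕ.m≤n⇒m≤1+n l≤k) , q

∖-leaf-isTree : IsTree G → Leaf G i → Nonempty (V (G ∖ i)) → IsTree (G ∖ i)
∖-leaf-isTree {G = G} tree leaf ne = record
  { nonempty  = ne
  ; connected = λ u∈ v∈ →
      let u∈G , u≢i = ∈-∖⁻ (V G) u∈
          v∈G , v≢i = ∈-∖⁻ (V G) v∈
      in map₂ proj₂ (bypass-leaf leaf (proj₂ (connected u∈G v∈G)) u≢i v≢i)
  ; acyclic   = λ (2≤ , uniq , linked) → acyclic (2≤ , uniq , Linked.map proj₁ linked)
  }
  where open IsTree tree

-- This direction carries the induction: distances in the shrinking tree stay bounded by those in
-- the original one.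
dist-∖-leaf : IsTree G → Leaf G i → u ∈ V (G ∖ i) → v ∈ V (G ∖ i) → dist (G ∖ i) u v ≤ dist G u v
dist-∖-leaf {G = G} {i = i} tree leaf u∈ v∈ =
  let u∈G , u≢i = ∈-∖⁻ (V G) u∈
      v∈G , v≢i = ∈-∖⁻ (V G) v∈
      l , l≤ , q = bypass-leaf leaf (dist-walk G (proj₂ (IsTree.connected tree u∈G v∈G))) u≢i v≢i
  in ℕ.≤-trans (dist-≤ (G ∖ i) q) l≤

dist≤diam : ∀ (G : Graph n) → u ∈ V G → v ∈ V G → dist G u v ≤ diam G
dist≤diam G u∈ v∈ = All.lookup (xs≤max 0 _)
  (∈-cartesianProductWith⁺ (dist G) (∈-vertices u∈) (∈-vertices v∈))
  where
  ∈-vertices : ∀ {u} → u ∈ V G → u ∈ˡ vertices G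
  ∈-vertices = ∈-filter⁺ (_∈? V G) (∈-allFin _)

dist-sym : IsTree G → u ∈ V G → v ∈ V G → dist G u v ≤ dist G v u
dist-sym {G = G} tree u∈ v∈ =
  dist-≤ G (reverseʷ (dist-walk G (proj₂ (IsTree.connected tree v∈ u∈))))

dist-refl : ∀ (G : Graph n) → u ∈ V G → dist G u u ≡ 0
dist-refl G u∈ = ℕ.n≤0⇒n≡0 (dist-≤ G (nil u∈))

dist-positive : IsTree G → u ∈ V G → v ∈ V G → u ≢ v → 1 ≤ dist G u v
dist-positive {G = G} tree u∈ v∈ u≢v = positive (dist-walk G (proj₂ (IsTree.connected tree u∈ v∈)))
  where
  positive : ∀ {k} → Walk G k _ _ → 1 ≤ k
  positive (nil _)    = contradiction refl u≢v
  positive (cons _ _) = s≤s z≤n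

diametral-sym : ∀ {T : Graph n} → IsTree T → Diametral T i j → Diametral T j i
diametral-sym {T = T} tree d = record
  { i∈V   = j∈V
  ; j∈V   = i∈V
  ; i≢j   = i≢j ∘ sym
  ; dist≡ = trans (ℕ.≤-antisym (dist-sym tree j∈V i∈V) (dist-sym tree i∈V j∈V)) dist≡
  }
  where open Diametral d

diametral⇒leaf : ∀ {T : Graph n} → IsTree T → Diametral T i j → Leaf T i
diametral⇒leaf {T = T} tree d = eccentric⇒leaf tree i∈V j∈V i≢j
  λ u∈ → ℕ.≤-trans (dist≤diam T u∈ j∈V) (ℕ.≤-reflexive (sym dist≡))
  where open Diametral d

-- Permutations and cycle counts

iter-cong : ∀ {π ρ : Permutation′ n} → π ≈ ρ → ∀ k u → iter π k u ≡ iter ρ k u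
iter-cong             π≈ρ zero    u = refl
iter-cong {π = π} {ρ} π≈ρ (suc k) u = trans (π≈ρ _) (cong (ρ ⟨$⟩ʳ_) (iter-cong {π = π} {ρ} π≈ρ k u))

orbit-cong : ∀ {π ρ : Permutation′ n} → π ≈ ρ → ∀ u → orbit π u ≡ orbit ρ u
orbit-cong {π = π} {ρ} π≈ρ u = ⊆-antisym (orbit-⊆ {π = π} {ρ} π≈ρ) (orbit-⊆ {π = ρ} {π} (λ x → sym (π≈ρ x)))
  where
  orbit-⊆ : ∀ {π ρ : Permutation′ _} → π ≈ ρ → orbit π u ⊆ orbit ρ u
  orbit-⊆ {π} {ρ} π≈ρ x∈ =
    let k , eq = Equivalence.to (∈-orbit π) x∈
    in Equivalence.from (∈-orbit ρ) (k , trans (sym (iter-cong {π = π} {ρ} π≈ρ k u)) eq)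

-- The enumeration behind `maxPerm` reaches a permutation only up to `≈`, so the maximised quantity
-- has to respect `≈`.
cycleCount-cong : ∀ {π ρ : Permutation′ n} → π ≈ ρ → cycleCount π ≡ cycleCount ρ
cycleCount-cong {n} {π} {ρ} π≈ρ =
  cong (length ∘ deduplicate (≡-dec _≟ᵇ_)) (map-cong (orbit-cong {π = π} {ρ} π≈ρ) (allFin n))

iter-involution : ∀ (π : Permutation′ n) → (∀ u → π ⟨$⟩ʳ (π ⟨$⟩ʳ u) ≡ u) →
                  ∀ k u → iter π k u ≡ u ⊎ iter π k u ≡ π ⟨$⟩ʳ u
iter-involution π inv zero    u = inj₁ refl
iter-involution π inv (suc k) u with iter-involution π inv k u
... | inj₁ eq = inj₂ (cong (π ⟨$⟩ʳ_) eq)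
... | inj₂ eq = inj₁ (trans (cong (π ⟨$⟩ʳ_) eq) (inv u))

-- Sending `a` to the position of the orbit of `rep a` in the deduplicated list is injective: equal
-- positions mean equal orbits, so `rep b` is an iterate of `rep a`.
representatives≤cycleCount : ∀ (π : Permutation′ n) {m} (rep : Fin m → Fin n) →
  (∀ k {a b} → iter π k (rep a) ≡ rep b → a ≡ b) → m ≤ cycleCount π
representatives≤cycleCount {n} π rep separated = injective⇒≤ {f = index ∘ orbit∈} λ {a} {b} eq →
  let k , k-eq = Equivalence.to (∈-orbit π)
        (subst (rep b ∈_) (sym (index-injective (setoid _) (orbit∈ a) (orbit∈ b) eq))
          (Equivalence.from (∈-orbit π) (0 , refl)))
  in separated k k-eq
  where
  orbit∈ : ∀ a → orbit π (rep a) ∈ˡ deduplicate (≡-dec _≟ᵇ_) (map (orbit π) (allFin n))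
  orbit∈ a = ∈-deduplicate⁺ (≡-dec _≟ᵇ_) (∈-map⁺ (orbit π) (∈-allFin (rep a)))

by-cases : ∀ {i j : Fin n} (P : Fin n → Set) → P i → P j →
           (∀ {u} → u ≢ i → u ≢ j → P u) → ∀ u → P u
by-cases {i = i} {j = j} P pi pj other u with u ≟ i | u ≟ j
... | yes refl | _        = pi
... | no _     | yes refl = pj
... | no u≢i   | no u≢j   = other u≢i u≢j

transpose-first : ∀ (i j : Fin n) → transpose i j ⟨$⟩ʳ i ≡ j
transpose-first i j with i ≟ i
... | yes _  = refl
... | no i≢i = contradiction refl i≢i

transpose-second : ∀ (i j : Fin n) → transpose i j ⟨$⟩ʳ j ≡ i
transpose-second i j with j ≟ i
... | yes j≡i = j≡i
... | no _ with j ≟ j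
...   | yes _  = refl
...   | no j≢j = contradiction refl j≢j

transpose-other : u ≢ i → u ≢ j → transpose i j ⟨$⟩ʳ u ≡ u
transpose-other {u = u} {i = i} {j = j} u≢i u≢j with u ≟ i
... | yes u≡i = contradiction u≡i u≢i
... | no _ with u ≟ j
...   | yes u≡j = contradiction u≡j u≢j
...   | no _    = refl

-- Sums under pointwise increase.

module _ {A : Set} {f g : A → ℕ} (f≤g : ∀ x → f x ≤ g x) where

  sum-mono : ∀ xs → sum (map f xs) ≤ sum (map g xs)
  sum-mono []       = z≤n
  sum-mono (x ∷ xs) = ℕ.+-mono-≤ (f≤g x) (sum-mono xs)

  sum-increase : ∀ {x xs d} → x ∈ˡ xs → d + f x ≤ g x → d + sum (map f xs) ≤ sum (map g xs)
  sum-increase {d = d} (here {xs = xs} refl) d≤ =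
    ℕ.≤-trans (ℕ.≤-reflexive (sym (ℕ.+-assoc d _ _))) (ℕ.+-mono-≤ d≤ (sum-mono xs))
  sum-increase {d = d} (there {x = y} x∈) d≤ =
    ℕ.≤-trans (ℕ.≤-reflexive (ℕ+.x∙yz≈y∙xz d (f y) _)) (ℕ.+-mono-≤ (f≤g y) (sum-increase x∈ d≤))

  -- Since `x ≢ y`, the two gains of `d` occur at different positions of the list and add up.
  sum-increase₂ : ∀ {x y xs d} → x ≢ y → x ∈ˡ xs → y ∈ˡ xs → d + f x ≤ g x → d + f y ≤ g y →
                  d + d + sum (map f xs) ≤ sum (map g xs)
  sum-increase₂ x≢y (here refl) (here refl) _ _ = contradiction refl x≢y
  sum-increase₂ {d = d} _ (here {xs = xs} refl) (there y∈) dx dy =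
    ℕ.≤-trans (ℕ.≤-reflexive (ℕ+.interchange d d _ _)) (ℕ.+-mono-≤ dx (sum-increase y∈ dy))
  sum-increase₂ {d = d} _ (there x∈) (here {xs = xs} refl) dx dy =
    ℕ.≤-trans (ℕ.≤-reflexive (ℕ+.interchange d d _ _)) (ℕ.+-mono-≤ dy (sum-increase x∈ dx))
  sum-increase₂ {d = d} x≢y (there {x = z} x∈) (there y∈) dx dy =
    ℕ.≤-trans (ℕ.≤-reflexive (ℕ+.x∙yz≈y∙xz (d + d) (f z) _))
      (ℕ.+-mono-≤ (f≤g z) (sum-increase₂ x≢y x∈ y∈ dx dy))

-- Involutions that certify the lower bound.

displacement : (Fin n → Fin n → ℕ) → Permutation′ n → ℕ
displacement {n} D π = sum (map (λ u → D u (π ⟨$⟩ʳ u)) (allFin n))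

-- The vertices rep a lie in pairwise different cycles of perm, so size bounds
-- its number of cycles from below.

record Witness (D : Fin n → Fin n → ℕ) (P : Subset n) (s : ℤ) : Set where
  field
    perm          : Permutation′ n
    involutive    : ∀ u → perm ⟨$⟩ʳ (perm ⟨$⟩ʳ u) ≡ u
    fixes         : ∀ {u} → u ∉ P → perm ⟨$⟩ʳ u ≡ u
    size          : ℕ
    rep           : Fin size → Fin n
    rep-injective : Injective _≡_ _≡_ rep
    rep-separated : ∀ {a b} → perm ⟨$⟩ʳ rep a ≡ rep b → a ≡ b
    bound         : s ≤ℤ + size -ℤ + n +ℤ + displacement D perm

module _ (D : Fin n → Fin n → ℕ) (D-refl : ∀ u → D u u ≡ 0) where

  -- The `n` fixed points cancel `- n`, and the displacement is nonnegative.
  identity-witness : ∀ {P} {s : ℤ} → s ≤ℤ 0ℤ → Witness D P s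
  identity-witness s≤0 = record
    { perm          = id
    ; involutive    = λ _ → refl
    ; fixes         = λ _ → refl
    ; size          = n
    ; rep           = λ u → u
    ; rep-injective = λ eq → eq
    ; rep-separated = λ eq → eq
    ; bound         = ℤ.≤-trans s≤0 (ℤ.≤-trans (ℤ.≤-reflexive (sym (ℤ.+-inverseʳ (+ n))))
                        (ℤ.i≤i+j (+ n -ℤ + n) (+ displacement D id)))
    }

  -- When the cycles of `i` and `j` merge, `j` must cease to be a representative. By injectivity of
  -- `rep` this drops at most one index.
  omit : ∀ {m} (rep : Fin m → Fin n) → Injective _≡_ _≡_ rep → ∀ j →
         ∃[ m′ ] ∃[ f ] m ≤ suc m′ × Injective {A = Fin m′} _≡_ _≡_ f × (∀ a → rep (f a) ≢ j)
  omit {m} rep inj j with any? (λ a → rep a ≟ j)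
  ... | no  j∉ = m , (λ a → a) , ℕ.n≤1+n m , (λ eq → eq) , λ a eq → j∉ (a , eq)
  omit {suc m} rep inj j | yes (a , refl) =
    m , punchIn a , ℕ.≤-refl , punchIn-injective a _ _ , λ b eq → punchInᵢ≢i a b (inj eq)

  -- The given involution fixes `i` and `j`, so composing it with their transposition only joins
  -- these two fixed points. At most one representative is lost and each of the two points gains
  -- `d`, for a net change of at least `2d - 1`.
  transpose-witness : ∀ {P s} d → i ∈ P → j ∈ P → i ≢ j → d ≤ D i j → d ≤ D j i →
                      Witness D (P - i - j) s → Witness D P (s +ℤ (+ 2 *ℤ + d -ℤ 1ℤ))
  transpose-witness {i = i} {j = j} {P = P} {s = s} d i∈ j∈ i≢j d≤ d≤′ W with omit rep rep-injective j
    where open Witness W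
  ... | m′ , f , m≤ , f-injective , avoids = record
    { perm          = π
    ; involutive    = inv
    ; fixes         = λ {u} u∉ → trans (π-other (λ { refl → u∉ i∈ }) (λ { refl → u∉ j∈ }))
                        (fixes (λ u∈ → u∉ (proj₁ (∈-∖⁻ P (proj₁ (∈-∖⁻ (P - i) u∈))))))
    ; size          = m′
    ; rep           = rep ∘ f
    ; rep-injective = f-injective ∘ rep-injective
    ; rep-separated = separated
    ; bound         = bound′
    }
    where
    open Witness W

    i∉ : i ∉ P - i - j
    i∉ i∈′ = x∉p-x P (proj₁ (∈-∖⁻ (P - i) i∈′))

    j∉ : j ∉ P - i - j
    j∉ = x∉p-x (P - i)

    π : Permutation′ n
    π = transpose i j ∘ₚ perm

    π-i : π ⟨$⟩ʳ i ≡ j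
    π-i = trans (cong (perm ⟨$⟩ʳ_) (transpose-first i j)) (fixes j∉)

    π-j : π ⟨$⟩ʳ j ≡ i
    π-j = trans (cong (perm ⟨$⟩ʳ_) (transpose-second i j)) (fixes i∉)

    π-other : ∀ {u} → u ≢ i → u ≢ j → π ⟨$⟩ʳ u ≡ perm ⟨$⟩ʳ u
    π-other u≢i u≢j = cong (perm ⟨$⟩ʳ_) (transpose-other u≢i u≢j)

    moves-off : ∀ {u v} → v ∉ P - i - j → u ≢ v → perm ⟨$⟩ʳ u ≢ v
    -- A fixed point of an involution is the image of itself alone.
    moves-off {u} v∉ u≢v eq = u≢v (trans (sym (involutive u)) (trans (cong (perm ⟨$⟩ʳ_) eq) (fixes v∉)))

    inv : ∀ u → π ⟨$⟩ʳ (π ⟨$⟩ʳ u) ≡ u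
    inv = by-cases (λ u → π ⟨$⟩ʳ (π ⟨$⟩ʳ u) ≡ u)
      (trans (cong (π ⟨$⟩ʳ_) π-i) π-j)
      (trans (cong (π ⟨$⟩ʳ_) π-j) π-i)
      (λ {u} u≢i u≢j → trans (cong (π ⟨$⟩ʳ_) (π-other u≢i u≢j))
        (trans (π-other (moves-off i∉ u≢i) (moves-off j∉ u≢j)) (involutive u)))

    separated : ∀ {a b} → π ⟨$⟩ʳ rep (f a) ≡ rep (f b) → a ≡ b
    separated {a} {b} eq = by-cases (λ u → rep (f a) ≡ u → a ≡ b)
      -- If `i` is a representative, its image is `j`, which `omit` has removed.
      (λ ≡i → contradiction (trans (sym eq) (trans (cong (π ⟨$⟩ʳ_) ≡i) π-i)) (avoids b))
      (λ ≡j → contradiction ≡j (avoids a))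
      (λ { ≢i ≢j refl → f-injective (rep-separated (trans (sym (π-other ≢i ≢j)) eq)) })
      (rep (f a)) refl

    fixed-cost : ∀ {u} → u ∉ P - i - j → D u (perm ⟨$⟩ʳ u) ≡ 0
    fixed-cost u∉ = trans (cong (D _) (fixes u∉)) (D-refl _)

    cost-mono : ∀ u → D u (perm ⟨$⟩ʳ u) ≤ D u (π ⟨$⟩ʳ u)
    cost-mono = by-cases (λ u → D u (perm ⟨$⟩ʳ u) ≤ D u (π ⟨$⟩ʳ u))
      (ℕ.≤-trans (ℕ.≤-reflexive (fixed-cost i∉)) z≤n)
      (ℕ.≤-trans (ℕ.≤-reflexive (fixed-cost j∉)) z≤n)
      (λ {u} u≢i u≢j → ℕ.≤-reflexive (cong (D u) (sym (π-other u≢i u≢j))))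

    cost-increase : ∀ {u v} → u ∉ P - i - j → π ⟨$⟩ʳ u ≡ v → d ≤ D u v →
                    d + D u (perm ⟨$⟩ʳ u) ≤ D u (π ⟨$⟩ʳ u)
    cost-increase u∉ refl d≤ =
      ℕ.≤-trans (ℕ.≤-reflexive (trans (cong (λ c → d + c) (fixed-cost u∉)) (ℕ.+-identityʳ d))) d≤

    displacement-increase : d + d + displacement D perm ≤ displacement D π
    displacement-increase = sum-increase₂ cost-mono i≢j (∈-allFin i) (∈-allFin j)
      (cost-increase i∉ π-i d≤) (cost-increase j∉ π-j d≤′)

    rearrange : ∀ m n d x → (1ℤ +ℤ m) -ℤ n +ℤ x +ℤ (+ 2 *ℤ d -ℤ 1ℤ) ≡ m -ℤ n +ℤ (d +ℤ d +ℤ x)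
    rearrange = solve-∀

    bound′ : s +ℤ (+ 2 *ℤ + d -ℤ 1ℤ) ≤ℤ + m′ -ℤ + n +ℤ + displacement D π
    bound′ = begin
      s +ℤ (+ 2 *ℤ + d -ℤ 1ℤ)
        ≤⟨ ℤ.+-monoˡ-≤ _ bound ⟩
      + size -ℤ + n +ℤ + displacement D perm +ℤ (+ 2 *ℤ + d -ℤ 1ℤ)
        -- The successor in `suc m′` pays for the `- 1ℤ` in the gain of the pair.
        ≤⟨ ℤ.+-monoˡ-≤ _ (ℤ.+-monoˡ-≤ (+ displacement D perm) (ℤ.+-monoˡ-≤ (ℤ.- + n) (ℤ.+≤+ m≤))) ⟩
      + suc m′ -ℤ + n +ℤ + displacement D perm +ℤ (+ 2 *ℤ + d -ℤ 1ℤ)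
        ≡⟨ rearrange (+ m′) (+ n) (+ d) (+ displacement D perm) ⟩
      + m′ -ℤ + n +ℤ + (d + d + displacement D perm)
        ≤⟨ ℤ.+-monoʳ-≤ (+ m′ -ℤ + n) (ℤ.+≤+ displacement-increase) ⟩
      + m′ -ℤ + n +ℤ + displacement D π ∎
      where open ℤ.≤-Reasoning

  -- Induction along a run of the algorithm.

  module _ (D-positive : ∀ {u v} → u ≢ v → 1 ≤ D u v) where

    small-witness : ∀ P → ∣ P ∣ < 3 → Witness D P (+ ∣ P ∣ -ℤ 1ℤ)
    small-witness P <3 with ∣ P ∣ in ∣P∣≡
    ... | 0 = identity-witness ℤ.-≤+
    ... | 1 = identity-witness ℤ.≤-refl
    -- Swapping the last two vertices with the lower bound `d = 1` gains `2 * 1 - 1 = 1`, which is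
    -- the final summand of the algorithm.
    ... | 2 = let x , y , x∈ , y∈ , x≢y = ∣p∣>1⇒distinct P (ℕ.≤-reflexive (sym ∣P∣≡))
              in transpose-witness {s = 0ℤ} 1 x∈ y∈ x≢y (D-positive x≢y) (D-positive (x≢y ∘ sym))
                   (identity-witness ℤ.≤-refl)
    small-witness P (s≤s (s≤s (s≤s ()))) | suc (suc (suc _))

    -- `D` stays fixed while `T` shrinks; the invariant `dist T u v ≤ D u v` lets every deleted pair
    -- be charged to `D`. The target `r - β` is what the rest of the run adds to the accumulator, so
    -- the recursion on the run peels off one pair at a time.
    run⇒witness : ∀ {T β r} → IsTree T → (∀ {u v} → u ∈ V T → v ∈ V T → dist T u v ≤ D u v) →
                  Run T β r → Witness D (V T) (r -ℤ β)
    run⇒witness {T} tree dist≤D (loop {β = β} {r} {i} {j} diametral 3≤ run) =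
      subst (Witness D (V T)) (rearrange r β _)
        (transpose-witness (diam T) i∈V j∈V i≢j
          (ℕ.≤-trans (ℕ.≤-reflexive (sym dist≡)) (dist≤D i∈V j∈V))
          (ℕ.≤-trans (ℕ.≤-reflexive (sym (Diametral.dist≡ diametral′))) (dist≤D j∈V i∈V))
          (run⇒witness
            (∖-leaf-isTree tree∖i leaf-j (∣p∣>0⇒Nonempty _ (ℕ.≤-trans (s≤s z≤n) 3≤)))
            (λ u∈ v∈ → let u∈′ = proj₁ (∈-∖⁻ (V (T ∖ i)) u∈)
                           v∈′ = proj₁ (∈-∖⁻ (V (T ∖ i)) v∈)
              in ℕ.≤-trans (dist-∖-leaf tree∖i leaf-j u∈ v∈)
                (ℕ.≤-trans (dist-∖-leaf tree leaf-i u∈′ v∈′)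
                  (dist≤D (proj₁ (∈-∖⁻ (V T) u∈′)) (proj₁ (∈-∖⁻ (V T) v∈′)))))
            run))
      where
      open Diametral diametral
      diametral′ = diametral-sym tree diametral

      leaf-i : Leaf T i
      leaf-i = diametral⇒leaf tree diametral

      leaf-j : Leaf (T ∖ i) j
      leaf-j (a , _) (b , _) = diametral⇒leaf tree diametral′ a b

      tree∖i : IsTree (T ∖ i)
      tree∖i = ∖-leaf-isTree tree leaf-i (j , x∈p∧x≢y⇒x∈p-y j∈V (i≢j ∘ sym))

      rearrange : ∀ r β c → r -ℤ (β +ℤ c) +ℤ c ≡ r -ℤ β
      rearrange = solve-∀
    run⇒witness {T} tree dist≤D (halt {β = β} {i} {j} diametral <3) =
      subst (Witness D (V T)) (rearrange β _ _)
        (transpose-witness (diam T) i∈V j∈V i≢j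
          (ℕ.≤-trans (ℕ.≤-reflexive (sym dist≡)) (dist≤D i∈V j∈V))
          (ℕ.≤-trans (ℕ.≤-reflexive (sym (Diametral.dist≡ (diametral-sym tree diametral)))) (dist≤D j∈V i∈V))
          (small-witness _ <3))
      where
      open Diametral diametral

      rearrange : ∀ β c x → x +ℤ c ≡ β +ℤ c +ℤ x -ℤ β
      rearrange = solve-∀

theorem12 : (n : ℕ) → 5 ≤ n →
    (T : Graph n) → V T ≡ ⊤ → IsTree T →
    (β : ℤ) → AlgorithmA T β →
    β ≤ℤ maxPerm (λ π → + cycleCount π -ℤ + n +ℤ + sum (map (λ i → dist T i (π ⟨$⟩ʳ i)) (allFin n)))
theorem12 n _ T V≡⊤ tree β run = begin
  β
    ≡⟨ ℤ.+-identityʳ β ⟨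
  β -ℤ 0ℤ
    ≤⟨ bound ⟩
  + size -ℤ + n +ℤ + displacement (dist T) perm
    ≤⟨ ℤ.+-monoˡ-≤ (+ displacement (dist T) perm) (ℤ.+-monoˡ-≤ (ℤ.- + n) (ℤ.+≤+ size≤)) ⟩
  value perm
    ≤⟨ maxPerm-upper value (λ {π} {ρ} → value-cong {π} {ρ}) perm ⟩
  maxPerm value ∎
  where
  open ℤ.≤-Reasoning

  all∈V : ∀ u → u ∈ V T
  all∈V u = subst (u ∈_) (sym V≡⊤) ∈⊤

  -- With `D` the distance in the full tree, the invariant starts as an equality. As `V T` is
  -- everything, `D` vanishes on the diagonal and is positive off it.
  open Witness (run⇒witness (dist T) (λ u → dist-refl T (all∈V u))
    (λ {u} {v} → dist-positive tree (all∈V u) (all∈V v)) tree (λ _ _ → ℕ.≤-refl) run)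

  value : Permutation′ n → ℤ
  value π = + cycleCount π -ℤ + n +ℤ + displacement (dist T) π

  value-cong : ∀ {π ρ} → π ≈ ρ → value π ≡ value ρ
  value-cong {π} {ρ} π≈ρ = cong₂ (λ c x → + c -ℤ + n +ℤ + x) (cycleCount-cong {π = π} {ρ} π≈ρ)
    (cong sum (map-cong (λ u → cong (dist T u) (π≈ρ u)) (allFin n)))

  size≤ : size ≤ cycleCount perm
  -- Every iterate of an involution acts at a point as the identity or as `perm`, so one-step
  -- separation and injectivity of `rep` suffice.
  size≤ = representatives≤cycleCount perm rep λ k {a} eq →
    [ (λ fix  → rep-injective (trans (sym fix) eq))
    , (λ move → rep-separated (trans (sym move) eq))
    ]′ (iter-involution perm involutive k (rep a))
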